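{- Let $q\ge 2$, $n\ge 1$, $h\in F(n,q)$ and $u\in\Pi([n])$. Then $$\kappa(h,u)=\left\lceil \log_q\big(\chi(G_{h,u})\big)\right\rceil ,$$ where $\chi(G_{h,u})$ is the chromatic number of the confusion graph $G_{h,u}$.
   Context: Let $q\ge 2$, $A=\{0,1,\dots,q-1\}$, $[n]=\{1,\dots,n\}$, and let $F(n,q)$ be the set of all maps $A^n\to A^n$ (automata networks). For $f\in F(m,q)$ and $i\in[m]$, $f_i:A^m\to A$ is the $i$-th coordinate function of $f$. The map $f^i\in F(m,q)$ is defined by $f^i(x)=(x_1,\dots,x_{i-1},f_i(x),x_{i+1},\dots,x_m)$. For $I\subseteq[m]$, $f^I\in F(m,q)$ is defined by $f^I(x)_j=f_j(x)$ if $j\in I$ and $f^I(x)_j=x_j$ otherwise. For a word $w=(w_1,\dots,w_t)$ over $[m]$, $f^w=f^{w_t}\circ\cdots\circ f^{w_1}$. $\Pi([m])$ is the set of permutations of $[m]$, written as words $w=(w_1,\dots,w_m)$ in which each element of $[m]$ occurs once; for $i\in[m]$, $w(i)$ denotes the position $j$ with $w_j=i$. $\mathrm{pr}_{[n]}:A^m\to A^n$ is the projection onto the first $n$ coordinates. For $m\ge n$, a pair $(f,w)$ with $f\in F(m,q)$, $w\in\Pi([m])$ sequentializes $h\in F(n,q)$ if $\mathrm{pr}_{[n]}\circ f^w=h\circ \mathrm{pr}_{[n]}$. For $u\in\Pi([n])$, $w\in\Pi([m])$ respects $u$ if for all $i,j\in[n]$, $u(i)<u(j)$ implies $w(i)<w(j)$.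 The cost of sequentialization $\kappa(h,u)$ is the smallest $k\ge 0$ such that there exist $f\in F(n+k,q)$ and $w\in\Pi([n+k])$ respecting $u$ such that $(f,w)$ sequentializes $h$. The confusion graph $G_{h,u}$ is the undirected graph with vertex set $A^n$ in which $x\neq x'$ are adjacent iff $h(x)\neq h(x')$ and there exists $i\in[n]$ with $h^{\{u_1,\dots,u_i\}}(x)=h^{\{u_1,\dots,u_i\}}(x')$. -}

module Defs where

open import Data.Bool using (if_then_else_)
open import Data.Fin as Fin using (Fin; _↑ˡ_)
open import Data.Fin.Permutation using (Permutation′; _⟨$⟩ʳ_; _⟨$⟩ˡ_)
open import Data.Fin.Subset using (Subset)
open import Data.List as List using (List; []; _∷_)
open import Data.Nat using (ℕ; zero; suc; _+_; _^_; _≤_; _≤?_; z≤n; s≤s)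
open import Data.Nat.Properties
  using (≤-antisym; n≤1+n; ≤-trans; ≤-reflexive; +-mono-≤; *-monoˡ-≤; +-identityʳ)
open import Data.Product using (∃; ∃-syntax; _×_; _,_; proj₁)
open import Data.Vec using (Vec; lookup; tabulate; take; _[_]≔_)
open import Function using (_∘_; id)
open import Relation.Binary.Definitions using (Symmetric)
open import Relation.Binary.PropositionalEquality using (_≡_; _≢_; refl; sym; cong)
open import Relation.Nullary using (¬_; does; yes; no; contradiction)
open import Relation.Unary using (Decidable)

IsLeast : (ℕ → Set) → ℕ → Set
IsLeast P k = P k × (∀ j → P j → k ≤ j)

IsLeast-unique : ∀ {P k l} → IsLeast P k → IsLeast P l → k ≡ l
IsLeast-unique (pk , k≤) (pl , l≤) = ≤-antisym (k≤ _ pl) (l≤ _ pk)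

least : ∀ {P : ℕ → Set} → Decidable P → ∀ n → P n → ∃ (IsLeast P)
least P? n pn with P? 0
... | yes p0 = 0 , p0 , λ _ _ → z≤n
least P? zero    pn | no ¬p0 = contradiction pn ¬p0
least P? (suc n) pn | no ¬p0 with least (P? ∘ suc) n pn
... | m , pm , m≤ = suc m , pm , λ where
  zero    p → contradiction p ¬p0
  (suc j) p → s≤s (m≤ j p)

n<q^n : ∀ {q} → 2 ≤ q → ∀ n → suc n ≤ q ^ n
n<q^n 2≤q zero = s≤s z≤n
n<q^n {q} 2≤q (suc n) = ≤-trans
  (+-mono-≤ (≤-trans (s≤s z≤n) ih) ih)
  (≤-trans (≤-reflexive (cong (q ^ n +_) (sym (+-identityʳ (q ^ n)))))
           (*-monoˡ-≤ (q ^ n) 2≤q))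
  where ih = n<q^n 2≤q n

leastExponent : ∀ {q} → 2 ≤ q → ∀ c → ∃ (IsLeast (λ e → c ≤ q ^ e))
leastExponent {q} 2≤q c =
  least (λ e → c ≤? q ^ e) c (≤-trans (n≤1+n c) (n<q^n 2≤q c))

-- For c ≥ 1, the least integer e with e ≥ log_q c is the least e : ℕ with
-- c ≤ q ^ e.  The value at c = 0 (namely 0) is junk.
⌈log[_]⌉ : ∀ {q} → 2 ≤ q → ℕ → ℕ
⌈log[ 2≤q ]⌉ c = proj₁ (leastExponent 2≤q c)

A^ : ℕ → ℕ → Set
A^ n q = Vec (Fin q) n

F : ℕ → ℕ → Set
F n q = A^ n q → A^ n q

-- A permutation w is the word (w ⟨$⟩ʳ 0, w ⟨$⟩ʳ 1, …), so that w ⟨$⟩ʳ j is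
-- the letter w_j, and w ⟨$⟩ˡ i is the position w(i) of the letter i.
Π : ℕ → Set
Π = Permutation′

word : ∀ {m} → Π m → List (Fin m)
word w = List.tabulate (w ⟨$⟩ʳ_)

module _ {m q : ℕ} (f : F m q) where

  update : Fin m → F m q
  update i x = x [ i ]≔ lookup (f x) i

  updateSet : Subset m → F m q
  updateSet I x =
    tabulate λ j → if lookup I j then lookup (f x) j else lookup x j

  -- The first letter of the word is applied first.
  updateWord : List (Fin m) → F m q
  updateWord []      = id
  updateWord (i ∷ w) = updateWord w ∘ update i

Sequentializes : ∀ {n k q} → F (n + k) q → Π (n + k) → F n q → Set
Sequentializes {n} f w h =
  ∀ x → take n (updateWord f (word w) x) ≡ h (take n x)

Respects : ∀ {n k} → Π (n + k) → Π n → Set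
Respects {n} {k} w u = ∀ (i j : Fin n) →
  u ⟨$⟩ˡ i Fin.< u ⟨$⟩ˡ j → w ⟨$⟩ˡ (i ↑ˡ k) Fin.< w ⟨$⟩ˡ (j ↑ˡ k)

SequentializableWith : ∀ {n q} → F n q → Π n → ℕ → Set
SequentializableWith {n} {q} h u k =
  ∃[ f ] ∃[ w ] Respects {n} {k} w u × Sequentializes {n} {k} {q} f w h

-- κ(h,u) as a relation, single-valued by IsLeast-unique; likewise χ(G) below.
IsCost : ∀ {n q} → F n q → Π n → ℕ → Set
IsCost h u = IsLeast (SequentializableWith h u)

record Graph (V : Set) : Set₁ where
  field
    Adj       : V → V → Set
    symmetric : Symmetric Adj
    loopless  : ∀ {x} → ¬ Adj x x

Colourable : ∀ {V} → Graph V → ℕ → Set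
Colourable {V} G c =
  ∃ λ (φ : V → Fin c) → ∀ x y → Graph.Adj G x y → φ x ≢ φ y

IsChromaticNumber : ∀ {V} → Graph V → ℕ → Set
IsChromaticNumber G = IsLeast (Colourable G)

-- {u_1, …, u_i}; positions are counted from 0, so i = 0 gives {u_1}.
prefix : ∀ {n} → Π n → Fin n → Subset n
prefix u i = tabulate λ j → does (u ⟨$⟩ˡ j Fin.≤? i)

confusionGraph : ∀ {n q} → F n q → Π n → Graph (A^ n q)
confusionGraph h u = record
  { Adj = λ x y → x ≢ y × h x ≢ h y ×
      ∃[ i ] updateSet h (prefix u i) x ≡ updateSet h (prefix u i) y
  ; symmetric = λ (x≢y , hx≢hy , i , eq) →
      x≢y ∘ sym , hx≢hy ∘ sym , i , sym eq
  ; loopless = λ (x≢x , _) → x≢x refl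
  }

{-# OPTIONS --safe #-}
-- (h , u) can be sequentialized with k extra coordinates iff the confusion
-- graph has a proper colouring by A^k, that is, with q ^ k colours.
--
-- Since every letter occurs once in w, the state before position t agrees with
-- the final state on the letters already updated and with the initial state
-- elsewhere.  Given (f , w), colour x by the final values of the extra
-- coordinates when these start at a constant: if x and y have the same colour
-- and are confused by a prefix of u, then the two runs meet after that prefix,
-- so h x ≡ h y.  Conversely, given a colouring φ, first store φ x in the extra
-- coordinates; the letters of u are then updated in order, each reading off its
-- value from any x′ that has the stored colour and the present partial image,
-- since such an x′ satisfies h x′ ≡ h x.
module Submission where

open import Data.Fin as Fin using (Fin; zero; suc; toℕ; _↑ˡ_; _↑ʳ_)
import Data.Fin.Properties as Fin
open import Data.Fin.Permutation
  using (_⟨$⟩ʳ_; _⟨$⟩ˡ_; inverseˡ; inverseʳ; cast-id; _∘ₚ_)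
open import Data.Fin.Subset using (Subset)
open import Data.Bool using (true; false; if_then_else_)
open import Data.List as List using (List; []; _∷_)
import Data.List.Properties as List
open import Data.List.Relation.Unary.All using (All; []; _∷_)
open import Data.List.Relation.Unary.All.Properties using (tabulate⁺)
open import Data.Nat using (ℕ; zero; suc; _+_; _^_; _≤_; _<_; _<?_; z≤n; s≤s)
open import Data.Nat.Induction using (<-wellFounded)
open import Data.Nat.Properties
  using (<⇒≢; >⇒≢; ≮⇒≥; ≤-refl; ≤-reflexive; ≤-trans; <⇒≤; m≤m+n; +-comm;
         +-monoʳ-<; +-monoʳ-≤; <-≤-trans; ≤⇒≯; m≤n⇒m<n∨m≡n)
open import Data.Product using (∃; ∃₂; _×_; _,_; proj₁)
open import Data.Sum using (inj₁; inj₂)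
open import Data.Sum.Algebra using (⊎-comm)
open import Data.Sum.Function.Propositional using (_⊎-↔_)
open import Data.Vec using (Vec; lookup; tabulate; take; drop; _++_; replicate)
open import Data.Vec.Properties
  using (lookup∘update; lookup∘update′; lookup∘tabulate; tabulate∘lookup;
         tabulate-cong; lookup-++ˡ; lookup-++ʳ; take++drop≡id; ++-injective; ≡-dec)
open import Function using (_∘_; const)
open import Function.Bundles using (mk⇔)
open import Function.Construct.Composition using (_↔-∘_)
open import Function.Construct.Identity using (↔-id)
open import Function.Construct.Symmetry using (↔-sym)
open import Induction.WellFounded using (Acc; acc)
open import Relation.Binary.Definitions using (DecidableEquality)
open import Relation.Binary.PropositionalEquality
open import Relation.Nullary using (Dec; yes; no; does; contradiction; ¬?; _×-dec_; _→-dec_)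
open import Relation.Nullary.Decidable
  using (map′; dec-true; dec-false; does-⇔; decidable-stable)
open import Relation.Unary using (Decidable)
open import Defs

private
  variable
    A : Set
    k l m n q c : ℕ

-- Vectors, compared letterwise and split into two blocks

vec-ext : {x y : Vec A n} → (∀ i → lookup x i ≡ lookup y i) → x ≡ y
vec-ext {x = x} {y} eq =
  trans (sym (tabulate∘lookup x)) (trans (tabulate-cong eq) (tabulate∘lookup y))

take-++ : (x : Vec A n) (y : Vec A k) → take n (x ++ y) ≡ x
take-++ {n = n} x y = proj₁ (++-injective _ x (take++drop≡id n (x ++ y)))

lookup-take : (x : Vec A (n + k)) (i : Fin n) → lookup (take n x) i ≡ lookup x (i ↑ˡ k)
lookup-take {n = n} x i = trans (sym (lookup-++ˡ (take n x) (drop n x) i))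
  (cong (λ v → lookup v (i ↑ˡ _)) (take++drop≡id n x))

lookup-drop : (x : Vec A (n + k)) (j : Fin k) → lookup (drop n x) j ≡ lookup x (n ↑ʳ j)
lookup-drop {n = n} x j = trans (sym (lookup-++ʳ (take n x) (drop n x) j))
  (cong (λ v → lookup v (n ↑ʳ j)) (take++drop≡id n x))

↑-elim : (P : Fin (n + k) → Set) →
  (∀ i → P (i ↑ˡ k)) → (∀ j → P (n ↑ʳ j)) → ∀ i → P i
↑-elim {n} {k} P l r i with Fin.splitAt n i in eq
... | inj₁ a = subst P (Fin.splitAt⁻¹-↑ˡ eq) (l a)
... | inj₂ b = subst P (Fin.splitAt⁻¹-↑ʳ eq) (r b)

-- Searching the words over Fin q and the functions on them

encode : A^ n q → Fin (q ^ n)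
encode = Fin.funToFin ∘ lookup

decode : ∀ {n q} → Fin (q ^ n) → A^ n q
decode = tabulate ∘ Fin.finToFun

decode-encode : (x : A^ n q) → decode (encode x) ≡ x
decode-encode x = trans (tabulate-cong (Fin.finToFun-funToFin (lookup x))) (tabulate∘lookup x)

encode-injective : {x y : A^ n q} → encode x ≡ encode y → x ≡ y
encode-injective {x = x} {y} eq =
  trans (sym (decode-encode x)) (trans (cong decode eq) (decode-encode y))

-- Stands in for function extensionality: equal decoded vectors give only pointwise equal functions.
funToFin-cong : {f g : Fin m → Fin n} → f ≗ g → Fin.funToFin f ≡ Fin.funToFin g
funToFin-cong {zero}  eq = refl
funToFin-cong {suc m} eq = cong₂ Fin.combine (eq zero) (funToFin-cong (eq ∘ suc))

decode-injective : ∀ {n q} {i j : Fin (q ^ n)} → decode {n} {q} i ≡ decode j → i ≡ j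
decode-injective {n} {q} {i} {j} eq = begin
  i                                    ≡⟨ Fin.funToFin-finToFin {n} {q} i ⟨
  Fin.funToFin {n} (Fin.finToFun {q} i) ≡⟨ funToFin-cong pointwise ⟩
  Fin.funToFin {n} (Fin.finToFun {q} j) ≡⟨ Fin.funToFin-finToFin {n} {q} j ⟩
  j                                    ∎
  where
  open ≡-Reasoning
  pointwise : Fin.finToFun {q} {n} i ≗ Fin.finToFun j
  pointwise p = trans (sym (lookup∘tabulate _ p))
    (trans (cong (λ v → lookup v p) eq) (lookup∘tabulate _ p))

_≟ⱽ_ : DecidableEquality (A^ n q)
_≟ⱽ_ = ≡-dec Fin._≟_

anyWord? : {P : A^ n q → Set} → Decidable P → Dec (∃ P)
anyWord? {P = P} P? = map′
  (λ (i , p) → decode i , p)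
  (λ (x , p) → encode x , subst P (sym (decode-encode x)) p)
  (Fin.any? (P? ∘ decode))

allWords? : {P : A^ n q → Set} → Decidable P → Dec (∀ x → P x)
allWords? {P = P} P? = map′
  (λ p x → subst P (decode-encode x) (p (encode x)))
  (λ p → p ∘ decode)
  (Fin.all? (P? ∘ decode))

-- Chromatic numbers of decidable graphs on words

module _ {n q} (G : Graph (A^ n q)) (adj? : ∀ x y → Dec (Graph.Adj G x y)) where
  open Graph G

  Proper : (A^ n q → Fin c) → Set
  Proper φ = ∀ x y → Adj x y → φ x ≢ φ y

  proper? : (φ : A^ n q → Fin c) → Dec (Proper φ)
  proper? φ = allWords? λ x → allWords? λ y → adj? x y →-dec ¬? (φ x Fin.≟ φ y)

  -- A colouring is determined by its table of `q ^ n` values, itself a word over `Fin c`, so only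
  -- finitely many candidates need to be searched.
  colourable? : ∀ c → Dec (Colourable G c)
  colourable? c = map′
    (λ (v , p) → lookup v ∘ encode , p)
    (λ (φ , p) → tabulate (φ ∘ decode) , λ x y a →
      subst₂ _≢_ (sym (table φ x)) (sym (table φ y)) (p x y a))
    (anyWord? λ (v : A^ (q ^ n) c) → proper? (lookup v ∘ encode))
    where
    table : (φ : A^ n q → Fin c) → ∀ x → lookup (tabulate (φ ∘ decode)) (encode x) ≡ φ x
    table φ x = trans (lookup∘tabulate _ (encode x)) (cong φ (decode-encode x))

  encode-proper : Proper encode
  encode-proper x y a eq = loopless (subst (Adj x) (sym (encode-injective eq)) a)

  -- Giving every vertex its own colour is proper, which bounds the search by `q ^ n`.
  chromaticNumber : ∃ (IsChromaticNumber G)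
  chromaticNumber = least colourable? (q ^ n) (encode , encode-proper)

Colourable-mono : ∀ {V} {G : Graph V} → c ≤ l → Colourable G c → Colourable G l
Colourable-mono c≤l (φ , p) = (λ x → Fin.inject≤ (φ x) c≤l) ,
  λ x y a eq → p x y a (Fin.inject≤-injective c≤l c≤l _ _ eq)

-- Partial updates

module _ {f : F m q} {I : Subset m} {x : A^ m q} {i : Fin m} where

  lookup-updateSet-true : lookup I i ≡ true → lookup (updateSet f I x) i ≡ lookup (f x) i
  lookup-updateSet-true eq rewrite lookup∘tabulate
    (λ j → if lookup I j then lookup (f x) j else lookup x j) i | eq = refl

  lookup-updateSet-false : lookup I i ≡ false → lookup (updateSet f I x) i ≡ lookup x i
  lookup-updateSet-false eq rewrite lookup∘tabulate
    (λ j → if lookup I j then lookup (f x) j else lookup x j) i | eq = refl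

-- The comparison is strict, so `t = 0` gives the empty set, whereas every `prefix` contains at
-- least one letter.
before : Π m → ℕ → Subset m
before w t = tabulate λ i → does (toℕ (w ⟨$⟩ˡ i) <? t)

prefix≡before : (u : Π n) (i : Fin n) → prefix u i ≡ before u (suc (toℕ i))
prefix≡before u i = tabulate-cong λ j →
  does-⇔ (mk⇔ s≤s λ { (s≤s p) → p }) (u ⟨$⟩ˡ j Fin.≤? i) (toℕ (u ⟨$⟩ˡ j) <? suc (toℕ i))

module _ (w : Π m) (f : F m q) (x : A^ m q) {t : ℕ} {i : Fin m} where

  lookup-before-< : toℕ (w ⟨$⟩ˡ i) < t →
    lookup (updateSet f (before w t) x) i ≡ lookup (f x) i
  lookup-before-< p = lookup-updateSet-true {f = f} {I = before w t}
    (trans (lookup∘tabulate (λ j → does (toℕ (w ⟨$⟩ˡ j) <? t)) i) (dec-true (_ <? t) p))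

  lookup-before-≥ : t ≤ toℕ (w ⟨$⟩ˡ i) →
    lookup (updateSet f (before w t) x) i ≡ lookup x i
  lookup-before-≥ p = lookup-updateSet-false {f = f} {I = before w t}
    (trans (lookup∘tabulate (λ j → does (toℕ (w ⟨$⟩ˡ j) <? t)) i) (dec-false (_ <? t) (≤⇒≯ p)))

updateSet-before-zero : (w : Π m) (f : F m q) (x : A^ m q) →
  updateSet f (before w 0) x ≡ x
updateSet-before-zero w f x = vec-ext λ i → lookup-before-≥ w f x z≤n

-- Runs of a word in which every letter occurs once

All-take-tabulate : {P : A → Set} (t : ℕ) {s : Fin l → A} →
  (∀ j → toℕ j < t → P (s j)) → All P (List.take t (List.tabulate s))
All-take-tabulate zero p = []
All-take-tabulate {l = zero}  (suc t) p = []
All-take-tabulate {l = suc l} (suc t) p =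
  p zero (s≤s z≤n) ∷ All-take-tabulate t λ j j<t → p (suc j) (s≤s j<t)

All-drop-tabulate : {P : A → Set} (t : ℕ) {s : Fin l → A} →
  (∀ j → t ≤ toℕ j → P (s j)) → All P (List.drop t (List.tabulate s))
All-drop-tabulate zero p = tabulate⁺ λ j → p j z≤n
All-drop-tabulate {l = zero}  (suc t) p = []
All-drop-tabulate {l = suc l} (suc t) p =
  All-drop-tabulate t λ j t≤j → p (suc j) (s≤s t≤j)

module _ (f : F m q) where

  updateWord-++ : ∀ v v′ x →
    updateWord f (v List.++ v′) x ≡ updateWord f v′ (updateWord f v x)
  updateWord-++ []      v′ x = refl
  updateWord-++ (i ∷ v) v′ x = updateWord-++ v v′ (update f i x)

  updateWord-∉ : ∀ {v i} → All (i ≢_) v → ∀ x → lookup (updateWord f v x) i ≡ lookup x i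
  updateWord-∉ []          x = refl
  updateWord-∉ (i≢j ∷ i≢v) x =
    trans (updateWord-∉ i≢v (update f _ x)) (lookup∘update′ i≢j x _)

  module _ (w : Π m) where

    run : F m q
    run = updateWord f (word w)

    state : ℕ → F m q
    state t = updateWord f (List.take t (word w))

    run-from-state : ∀ t x → run x ≡ updateWord f (List.drop t (word w)) (state t x)
    run-from-state t x = trans
      (cong (λ v → updateWord f v x) (sym (List.take++drop≡id t (word w))))
      (updateWord-++ (List.take t (word w)) (List.drop t (word w)) x)

    letter≢ : ∀ {i j} → toℕ (w ⟨$⟩ˡ i) ≢ toℕ j → i ≢ w ⟨$⟩ʳ j
    letter≢ ne refl = ne (cong toℕ (inverseˡ w))

    lookup-run-< : ∀ {t i} → toℕ (w ⟨$⟩ˡ i) < t → ∀ x →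
      lookup (run x) i ≡ lookup (state t x) i
    lookup-run-< {t} {i} i<t x = trans (cong (λ v → lookup v i) (run-from-state t x))
      (updateWord-∉ (All-drop-tabulate t λ j t≤j → letter≢ (<⇒≢ (<-≤-trans i<t t≤j))) _)

    lookup-state-≥ : ∀ {t i} → t ≤ toℕ (w ⟨$⟩ˡ i) → ∀ x →
      lookup (state t x) i ≡ lookup x i
    lookup-state-≥ {t} t≤i =
      updateWord-∉ (All-take-tabulate t λ j j<t → letter≢ (>⇒≢ (<-≤-trans j<t t≤i)))

    -- The set update uses `run` and not `f`: an updated letter is never touched again, so it
    -- already has its final value.
    state-mixed : ∀ t x → state t x ≡ updateSet run (before w t) x
    state-mixed t x = vec-ext λ i → case-< i (toℕ (w ⟨$⟩ˡ i) <? t)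
      where
      case-< : ∀ i → Dec (toℕ (w ⟨$⟩ˡ i) < t) →
        lookup (state t x) i ≡ lookup (updateSet run (before w t) x) i
      case-< i (yes p) = trans (sym (lookup-run-< p x)) (sym (lookup-before-< w run x p))
      case-< i (no ¬p) =
        trans (lookup-state-≥ (≮⇒≥ ¬p) x) (sym (lookup-before-≥ w run x (≮⇒≥ ¬p)))

    state-suc : ∀ p x → state (suc (toℕ p)) x ≡ update f (w ⟨$⟩ʳ p) (state (toℕ p) x)
    state-suc p x = trans
      (cong (λ v → updateWord f v x) (List.take-suc-tabulate (w ⟨$⟩ʳ_) p))
      (updateWord-++ (List.take (toℕ p) (word w)) _ x)

    lookup-run : ∀ i x → lookup (run x) i ≡ lookup (f (state (toℕ (w ⟨$⟩ˡ i)) x)) i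
    lookup-run i x = begin
      lookup (run x) i                               ≡⟨ lookup-run-< ≤-refl x ⟩
      lookup (state (suc (toℕ p)) x) i               ≡⟨ cong (λ v → lookup v i) (state-suc p x) ⟩
      lookup (update f (w ⟨$⟩ʳ p) (state (toℕ p) x)) i ≡⟨ cong (λ j → lookup (update f j (state (toℕ p) x)) i) (inverseʳ w) ⟩
      lookup (update f i (state (toℕ p) x)) i        ≡⟨ lookup∘update i (state (toℕ p) x) _ ⟩
      lookup (f (state (toℕ p) x)) i                 ∎
      where
      open ≡-Reasoning
      p = w ⟨$⟩ˡ i

    -- A guess `g` for the final state is right once each update yields its letter of `g` on the
    -- state expected under the guess. This goes by induction on the position of `i`: the state seen
    -- there depends only on `x` and on the final values of earlier letters.
    run-unique : ∀ {x g} →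
      (∀ i → lookup (f (updateSet (const g) (before w (toℕ (w ⟨$⟩ˡ i))) x)) i ≡ lookup g i) →
      run x ≡ g
    run-unique {x} {g} solves = vec-ext λ i → go i (<-wellFounded _)
      where
      go : ∀ i → Acc _<_ (toℕ (w ⟨$⟩ˡ i)) → lookup (run x) i ≡ lookup g i
      go i (acc rec) = begin
        lookup (run x) i                                 ≡⟨ lookup-run i x ⟩
        lookup (f (state t x)) i                         ≡⟨ cong (λ y → lookup (f y) i) (state-mixed t x) ⟩
        lookup (f (updateSet run (before w t) x)) i      ≡⟨ cong (λ y → lookup (f y) i) (vec-ext λ j → agree j (toℕ (w ⟨$⟩ˡ j) <? t)) ⟩
        lookup (f (updateSet (const g) (before w t) x)) i ≡⟨ solves i ⟩
        lookup g i                                       ∎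
        where
        open ≡-Reasoning
        t = toℕ (w ⟨$⟩ˡ i)
        agree : ∀ j → Dec (toℕ (w ⟨$⟩ˡ j) < t) →
          lookup (updateSet run (before w t) x) j ≡ lookup (updateSet (const g) (before w t) x) j
        agree j (yes p) = trans (lookup-before-< w run x p)
          (trans (go j (rec p)) (sym (lookup-before-< w (const g) x p)))
        agree j (no ¬p) = trans (lookup-before-≥ w run x (≮⇒≥ ¬p))
          (sym (lookup-before-≥ w (const g) x (≮⇒≥ ¬p)))

-- From a sequentialization to a colouring

module _ (h : F n q) (u : Π n) (f : F (n + k) q) (w : Π (n + k))
         (respects : Respects {n} {k} w u) (sequentializes : Sequentializes {n} {k} f w h)
         (a : Fin q) where

  private
    start : A^ n q → A^ (n + k) q
    start x = x ++ replicate k a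

    final : A^ n q → A^ (n + k) q
    final x = run f w (start x)

  take-final : ∀ x → take n (final x) ≡ h x
  take-final x = trans (sequentializes (start x)) (cong h (take-++ x _))

  finalColour : A^ n q → Fin (q ^ k)
  finalColour x = encode (drop n (final x))

  respects-≤ : ∀ i j → toℕ (u ⟨$⟩ˡ i) ≤ toℕ (u ⟨$⟩ˡ j) →
    toℕ (w ⟨$⟩ˡ (i ↑ˡ k)) ≤ toℕ (w ⟨$⟩ˡ (j ↑ˡ k))
  respects-≤ i j p with m≤n⇒m<n∨m≡n p
  ... | inj₁ i<j = <⇒≤ (respects i j i<j)
  ... | inj₂ i≡j = ≤-reflexive (cong (λ v → toℕ (w ⟨$⟩ˡ (v ↑ˡ k)))
    (trans (sym (inverseʳ u)) (trans (cong (u ⟨$⟩ʳ_) (Fin.toℕ-injective i≡j)) (inverseʳ u))))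

  -- Extra letters may be interleaved with the others anywhere in `w`. As `w` respects `u`, the main
  -- letters updated up to and including the letter at position `p` of `u` are exactly those of the
  -- prefix, and their final values are those of `h x`.
  state-after : ∀ x (p : Fin n) (i : Fin n) →
    lookup (state f w (suc (toℕ (w ⟨$⟩ˡ ((u ⟨$⟩ʳ p) ↑ˡ k)))) (start x)) (i ↑ˡ k)
      ≡ lookup (updateSet h (before u (suc (toℕ p))) x) i
  state-after x p i = trans (cong (λ v → lookup v (i ↑ˡ k)) (state-mixed f w t (start x)))
    (compare (toℕ (u ⟨$⟩ˡ i) <? suc (toℕ p)))
    where
    j = u ⟨$⟩ʳ p
    t = suc (toℕ (w ⟨$⟩ˡ (j ↑ˡ k)))
    j-position : toℕ (u ⟨$⟩ˡ j) ≡ toℕ p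
    j-position = cong toℕ (inverseˡ u)
    compare : Dec (toℕ (u ⟨$⟩ˡ i) < suc (toℕ p)) →
      lookup (updateSet (run f w) (before w t) (start x)) (i ↑ˡ k)
        ≡ lookup (updateSet h (before u (suc (toℕ p))) x) i
    compare (yes (s≤s i≤p)) = trans
      (lookup-before-< w (run f w) (start x)
        (s≤s (respects-≤ i j (≤-trans i≤p (≤-reflexive (sym j-position))))))
      (trans (sym (lookup-take (final x) i))
        (trans (cong (λ v → lookup v i) (take-final x))
          (sym (lookup-before-< u h x (s≤s i≤p)))))
    compare (no i≮p) = trans
      (lookup-before-≥ w (run f w) (start x)
        (respects j i (subst (_< toℕ (u ⟨$⟩ˡ i)) (sym j-position) (≮⇒≥ i≮p))))
      (trans (lookup-++ˡ x _ i) (sym (lookup-before-≥ u h x (≮⇒≥ i≮p))))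

  finalColour-proper : ∀ x y → Graph.Adj (confusionGraph h u) x y →
    finalColour x ≢ finalColour y
  finalColour-proper x y (_ , hx≢hy , p , confused) same = hx≢hy (begin
    h x              ≡⟨ take-final x ⟨
    take n (final x) ≡⟨ cong (take n) final≡ ⟩
    take n (final y) ≡⟨ take-final y ⟩
    h y              ∎)
    where
    open ≡-Reasoning
    t = suc (toℕ (w ⟨$⟩ˡ ((u ⟨$⟩ʳ p) ↑ˡ k)))

    confused′ : updateSet h (before u (suc (toℕ p))) x ≡ updateSet h (before u (suc (toℕ p))) y
    confused′ = subst (λ I → updateSet h I x ≡ updateSet h I y) (prefix≡before u p) confused

    extra : ∀ j → lookup (final x) (n ↑ʳ j) ≡ lookup (final y) (n ↑ʳ j)
    extra j = trans (sym (lookup-drop {n = n} (final x) j))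
      (trans (cong (λ v → lookup v j)
          (encode-injective {x = drop n (final x)} {drop n (final y)} same))
        (lookup-drop {n = n} (final y) j))

    -- An extra letter updated before `t` has its final value, which the common colour fixes; one
    -- not yet updated still holds `a` in both runs.
    extra-state : ∀ j → Dec (toℕ (w ⟨$⟩ˡ (n ↑ʳ j)) < t) →
      lookup (state f w t (start x)) (n ↑ʳ j) ≡ lookup (state f w t (start y)) (n ↑ʳ j)
    extra-state j (yes lt) =
      trans (sym (lookup-run-< f w lt (start x))) (trans (extra j) (lookup-run-< f w lt (start y)))
    extra-state j (no ¬lt) = trans (lookup-state-≥ f w (≮⇒≥ ¬lt) (start x))
      (trans (lookup-++ʳ x _ j)
        (trans (sym (lookup-++ʳ y _ j)) (sym (lookup-state-≥ f w (≮⇒≥ ¬lt) (start y)))))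

    state≡ : state f w t (start x) ≡ state f w t (start y)
    state≡ = vec-ext (↑-elim _
      (λ i → trans (state-after x p i)
        (trans (cong (λ v → lookup v i) confused′) (sym (state-after y p i))))
      (λ j → extra-state j (toℕ (w ⟨$⟩ˡ (n ↑ʳ j)) <? t)))

    final≡ : final x ≡ final y
    final≡ = trans (run-from-state f w t (start x))
      (trans (cong (updateWord f (List.drop t (word w))) state≡)
        (sym (run-from-state f w t (start y))))

-- From a colouring to a sequentialization

-- The word lists the extra letters and then the word `u`. The swap of summands is needed because
-- the extra letters come first as positions but last as coordinates.
extraFirst : ∀ k → Π n → Π (n + k)
extraFirst {n} k u =
  cast-id (+-comm n k) ∘ₚ
    (↔-sym Fin.+↔⊎ ↔-∘ (⊎-comm (Fin k) (Fin n) ↔-∘ ((↔-id (Fin k) ⊎-↔ u) ↔-∘ Fin.+↔⊎)))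

module _ (k : ℕ) (u : Π n) where

  extraFirst-ˡ : ∀ i → toℕ (extraFirst k u ⟨$⟩ˡ (i ↑ˡ k)) ≡ k + toℕ (u ⟨$⟩ˡ i)
  extraFirst-ˡ i rewrite Fin.splitAt-↑ˡ n i k =
    trans (Fin.toℕ-cast _ (k ↑ʳ _)) (Fin.toℕ-↑ʳ k _)

  extraFirst-ʳ : ∀ (j : Fin k) → toℕ (extraFirst k u ⟨$⟩ˡ (n ↑ʳ j)) ≡ toℕ j
  extraFirst-ʳ j rewrite Fin.splitAt-↑ʳ n k j =
    trans (Fin.toℕ-cast _ (j ↑ˡ n)) (Fin.toℕ-↑ˡ j n)

  extraFirst-respects : Respects {n} {k} (extraFirst k u) u
  extraFirst-respects i j i<j =
    subst₂ _<_ (sym (extraFirst-ˡ i)) (sym (extraFirst-ˡ j)) (+-monoʳ-< k i<j)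

module _ (h : F n q) (u : Π n) (φ : A^ n q → A^ k q)
         (proper : ∀ x y → Graph.Adj (confusionGraph h u) x y → φ x ≢ φ y) where

  private
    partial : ℕ → F n q
    partial t = updateSet h (before u t)

  -- Before position 0 nothing is updated, so `x` and `y` coincide. Before position `suc i` the
  -- updated letters form the prefix ending at position `i`, so different images would make `x` and
  -- `y` adjacent with the same colour.
  determined : ∀ i {x y} → φ x ≡ φ y →
    partial (toℕ {n} i) x ≡ partial (toℕ i) y → h x ≡ h y
  determined zero {x} {y} _ eq = cong h
    (trans (sym (updateSet-before-zero u h x)) (trans eq (updateSet-before-zero u h y)))
  determined (suc i) {x} {y} φ≡ eq = decidable-stable (h x ≟ⱽ h y) λ hx≢hy →
    proper x y (hx≢hy ∘ cong h , hx≢hy , Fin.inject₁ i , confused) φ≡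
    where
    prefix≡ : prefix u (Fin.inject₁ i) ≡ before u (suc (toℕ i))
    prefix≡ = trans (prefix≡before u _) (cong (before u ∘ suc) (Fin.toℕ-inject₁ i))
    confused : updateSet h (prefix u (Fin.inject₁ i)) x ≡ updateSet h (prefix u (Fin.inject₁ i)) y
    confused = subst (λ I → updateSet h I x ≡ updateSet h I y) (sym prefix≡) eq

  -- Here `z` stands for the main block at the moment when `i` is updated, and `c` for the stored
  -- colour.
  Source : Fin n → A^ n q → A^ k q → A^ n q → Set
  Source i z c x = partial (toℕ (u ⟨$⟩ˡ i)) x ≡ z × φ x ≡ c

  source? : ∀ i z c → Dec (∃ (Source i z c))
  source? i z c = anyWord? λ x → (_ ≟ⱽ z) ×-dec (φ x ≟ⱽ c)

  -- The value lookup z i is junk: a reachable state has a source.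
  recover : Fin n → A^ n q → A^ k q → Fin q
  recover i z c with source? i z c
  ... | yes (x , _) = lookup (h x) i
  ... | no _        = lookup z i

  -- The search may return some `y` other than `x`, but `determined` gives both the same image under
  -- `h`.
  recover-correct : ∀ i x → recover i (partial (toℕ (u ⟨$⟩ˡ i)) x) (φ x) ≡ lookup (h x) i
  recover-correct i x with source? i (partial (toℕ (u ⟨$⟩ˡ i)) x) (φ x)
  ... | yes (y , eq , φ≡) = cong (λ v → lookup v i) (determined (u ⟨$⟩ˡ i) φ≡ eq)
  ... | no ¬∃             = contradiction (x , refl , refl) ¬∃

  recoverAll : A^ (n + k) q → A^ n q
  recoverAll y = tabulate λ i → recover i (take n y) (drop n y)

  -- The two blocks are read at different times: the extra coordinates while the main block still
  -- holds the input, the main ones once the colour is stored.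
  network : F (n + k) q
  network y = recoverAll y ++ φ (take n y)

  network-run : ∀ y → run network (extraFirst k u) y ≡ h (take n y) ++ φ (take n y)
  network-run y = run-unique network w (↑-elim _ main extra)
    where
    open ≡-Reasoning
    w = extraFirst k u
    x = take n y
    g = h x ++ φ x

    mixed : ℕ → A^ (n + k) q
    mixed t = updateSet (const g) (before w t) y

    extra : ∀ j → lookup (network (mixed (toℕ (w ⟨$⟩ˡ (n ↑ʳ j))))) (n ↑ʳ j) ≡ lookup g (n ↑ʳ j)
    extra j = begin
      lookup (network (mixed t)) (n ↑ʳ j) ≡⟨ lookup-++ʳ (recoverAll (mixed t)) _ j ⟩
      lookup (φ (take n (mixed t))) j     ≡⟨ cong (λ v → lookup (φ v) j) unchanged ⟩
      lookup (φ x) j                      ≡⟨ lookup-++ʳ (h x) (φ x) j ⟨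
      lookup g (n ↑ʳ j)                   ∎
      where
      t = toℕ (w ⟨$⟩ˡ (n ↑ʳ j))
      -- Extra letters occupy the positions below `k` and main letters those from `k` on, so no main
      -- letter has been updated yet.
      unchanged : take n (mixed t) ≡ x
      unchanged = vec-ext λ i → trans (lookup-take (mixed t) i) (trans
        (lookup-before-≥ w (const g) y (subst₂ _≤_ (sym (extraFirst-ʳ k u j)) (sym (extraFirst-ˡ k u i))
          (≤-trans (<⇒≤ (Fin.toℕ<n j)) (m≤m+n k _))))
        (sym (lookup-take y i)))

    main : ∀ i → lookup (network (mixed (toℕ (w ⟨$⟩ˡ (i ↑ˡ k))))) (i ↑ˡ k) ≡ lookup g (i ↑ˡ k)
    main i = begin
      lookup (network (mixed t)) (i ↑ˡ k)              ≡⟨ lookup-++ˡ (recoverAll (mixed t)) _ i ⟩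
      lookup (recoverAll (mixed t)) i                  ≡⟨ lookup∘tabulate _ i ⟩
      recover i (take n (mixed t)) (drop n (mixed t))  ≡⟨ cong₂ (recover i) (vec-ext left) (vec-ext right) ⟩
      recover i (partial (toℕ (u ⟨$⟩ˡ i)) x) (φ x)     ≡⟨ recover-correct i x ⟩
      lookup (h x) i                                   ≡⟨ lookup-++ˡ (h x) (φ x) i ⟨
      lookup g (i ↑ˡ k)                                ∎
      where
      t = toℕ (w ⟨$⟩ˡ (i ↑ˡ k))
      s = toℕ (u ⟨$⟩ˡ i)

      compare : ∀ j → Dec (toℕ (u ⟨$⟩ˡ j) < s) →
        lookup (mixed t) (j ↑ˡ k) ≡ lookup (partial s x) j
      compare j (yes j<i) = trans
        (lookup-before-< w (const g) y (extraFirst-respects k u j i j<i))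
        (trans (lookup-++ˡ (h x) (φ x) j) (sym (lookup-before-< u h x j<i)))
      compare j (no j≮i) = trans
        (lookup-before-≥ w (const g) y
          (subst₂ _≤_ (sym (extraFirst-ˡ k u i)) (sym (extraFirst-ˡ k u j)) (+-monoʳ-≤ k (≮⇒≥ j≮i))))
        (trans (sym (lookup-take y j)) (sym (lookup-before-≥ u h x (≮⇒≥ j≮i))))

      left : ∀ j → lookup (take n (mixed t)) j ≡ lookup (partial s x) j
      left j = trans (lookup-take (mixed t) j) (compare j (_ <? s))

      right : ∀ j → lookup (drop n (mixed t)) j ≡ lookup (φ x) j
      right j = trans (lookup-drop {n = n} (mixed t) j) (trans
        (lookup-before-< w (const g) y (subst₂ _<_ (sym (extraFirst-ʳ k u j)) (sym (extraFirst-ˡ k u i))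
          (<-≤-trans (Fin.toℕ<n j) (m≤m+n k _))))
        (lookup-++ʳ (h x) (φ x) j))

  network-sequentializes : Sequentializes {n} {k} network (extraFirst k u) h
  network-sequentializes y = trans (cong (take n) (network-run y)) (take-++ (h (take n y)) _)

-- Cost and chromatic number

module _ (h : F n q) (u : Π n) where

  -- The given letter is the constant initial value of the extra coordinates.
  sequentializable⇒colourable : Fin q →
    SequentializableWith h u k → Colourable (confusionGraph h u) (q ^ k)
  sequentializable⇒colourable a (f , w , respects , sequentializes) =
    finalColour h u f w respects sequentializes a ,
    finalColour-proper h u f w respects sequentializes a

  colourable⇒sequentializable :
    Colourable (confusionGraph h u) (q ^ k) → SequentializableWith h u k
  colourable⇒sequentializable {k = k} (φ , proper) =
    network h u φ′ proper′ , extraFirst k u ,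
    extraFirst-respects k u , network-sequentializes h u φ′ proper′
    where
    φ′ : A^ n q → A^ k q
    φ′ = decode ∘ φ
    proper′ : ∀ x y → Graph.Adj (confusionGraph h u) x y → φ′ x ≢ φ′ y
    proper′ x y adj = proper x y adj ∘ decode-injective {n = k}

  confusion? : ∀ x y → Dec (Graph.Adj (confusionGraph h u) x y)
  confusion? x y = ¬? (x ≟ⱽ y) ×-dec ¬? (h x ≟ⱽ h y) ×-dec Fin.any? λ i → _ ≟ⱽ _

mainTheorem1 : (q n : ℕ) (2≤q : 2 ≤ q) → 1 ≤ n → (h : F n q) (u : Π n) →
    ∃₂ λ κ χ →
    IsCost h u κ × IsChromaticNumber (confusionGraph h u) χ × κ ≡ ⌈log[ 2≤q ]⌉ χ
mainTheorem1 q n 2≤q _ h u with chromaticNumber (confusionGraph h u) (confusion? h u)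
... | χ , colourable , χ≤ with leastExponent 2≤q χ in eq
... | κ , χ≤q^κ , κ≤ =
  κ , χ ,
  -- The cost is not searched for. By monotonicity and the minimality of `χ`, `q ^ j` colours
  -- suffice exactly when `χ ≤ q ^ j`, so the least such exponent is the least number of extra
  -- coordinates.
  ( colourable⇒sequentializable h u
      (Colourable-mono {G = confusionGraph h u} χ≤q^κ colourable)
  , λ j s → κ≤ j (χ≤ (q ^ j) (sequentializable⇒colourable h u a s))) ,
  (colourable , χ≤) ,
  sym (cong proj₁ eq)
  where
  a : Fin q
  a = Fin.fromℕ< (≤-trans (s≤s z≤n) 2≤q)
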